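{- Let $s$, $t$ and $\ell$ be integers with $\ell \geq 0$ and $3.5\ell + 2 \leq s \leq t$. Let $G$ be a multigraph and let $L(G)$ denote its line graph. If $\chi(L(G)) = s+t-1 > \omega(L(G))$, then $L(G)$ contains a clique $Q$ of size $s$ such that $\chi(L(G) - Q) \geq t + \ell$.
   Context: A multigraph may have multiple edges between the same pair of vertices. The line graph $L(G)$ of a multigraph $G$ has vertex set $E(G)$, two distinct edges being adjacent in $L(G)$ if and only if they share at least one endpoint. $\chi(H)$ denotes the chromatic number and $\omega(H)$ the clique number (size of a largest clique) of a graph $H$; $L(G)-Q$ denotes the graph obtained from $L(G)$ by deleting the vertices of $Q$. -}

module Defs where

open import Level using (0ℓ)
open import Data.Nat using (ℕ; _≤_)
open import Data.Fin using (Fin)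
open import Data.Product using (Σ; ∃; _×_; proj₁; proj₂)
open import Data.Sum using (_⊎_)
open import Data.List using (List; length)
open import Data.List.Membership.Propositional using (_∈_; _∉_)
open import Data.List.Relation.Unary.Unique.Propositional using (Unique)
open import Relation.Binary.PropositionalEquality using (_≡_; _≢_)

record Graph : Set₁ where
  field
    V   : Set
    Adj : V → V → Set
open Graph public

Colorable : Graph → ℕ → Set
Colorable H k = Σ (V H → Fin k) λ c → ∀ x y → Adj H x y → c x ≢ c y

IsChromaticNumber : Graph → ℕ → Set
IsChromaticNumber H k = Colorable H k × (∀ j → Colorable H j → k ≤ j)

ChromaticAtLeast : Graph → ℕ → Set
ChromaticAtLeast H k = ∀ j → Colorable H j → k ≤ j

IsClique : (H : Graph) → List (V H) → Set
IsClique H Q = Unique Q × (∀ x y → x ∈ Q → y ∈ Q → x ≢ y → Adj H x y)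

IsCliqueNumber : Graph → ℕ → Set
IsCliqueNumber H w =
  (∃ λ Q → IsClique H Q × length Q ≡ w) × (∀ Q → IsClique H Q → length Q ≤ w)

deleteVertices : (H : Graph) → List (V H) → Graph
deleteVertices H Q = record
  { V   = Σ (V H) (λ x → x ∉ Q)
  ; Adj = λ x y → Adj H (proj₁ x) (proj₁ y) }

record Multigraph : Set where
  field
    n    : ℕ
    m    : ℕ
    ends : Fin m → Fin n × Fin n
    loopless : ∀ e → proj₁ (ends e) ≢ proj₂ (ends e)
open Multigraph public

Incident : (G : Multigraph) → Fin (n G) → Fin (m G) → Set
Incident G v e = (v ≡ proj₁ (ends G e)) ⊎ (v ≡ proj₂ (ends G e))

LineGraph : Multigraph → Graph
LineGraph G = record
  { V   = Fin (m G)
  ; Adj = λ e f → e ≢ f × ∃ λ v → Incident G v e × Incident G v f }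

{-# OPTIONS --safe #-}
module Submission where

-- Put k = s + t − 2, so that G has no k-edge-colouring while every star and every triangle has at
-- most k edges.  Some vertex x has degree at least s, since otherwise greedy colouring uses at most
-- 2s − 2 ≤ k colours.  Q is a set of s edges at x; suppose G − Q is coloured with C = t + ℓ − 1
-- colours, so that C + |Q| = k + 1 + ℓ.  A contradiction arises once a colouring with C′ colours leaves a
-- set R of uncoloured edges with C′ + |R| ≤ k, as R can then be given |R| new colours.
--
-- Let xy, xz be uncoloured, y ≠ z, and let β be missing at x.  Spending one new colour α, both can
-- be coloured: if no β-edge joins y and z, recolour the β-edge at y with α and put β on xy and α on
-- xz.  If yz has colour β and all of R lies in the triangle xyz, then, the triangle having at most
-- k < C′ + |R| edges, some colour γ is absent from it; uncolour yz, swap β and γ on a Kempe chain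
-- that meets only one of x, y, z, and argue as before at that vertex with γ.  (If R has an edge xw
-- outside the triangle, w takes the role of z.)  Each round lowers C′ + |R| by one, and ℓ + 1 rounds
-- are possible unless all but at most ℓ edges at x go to a single neighbour y.
--
-- In that case every edge from x to a vertex other than y gets a new colour, which is shared with a
-- disjoint edge at y as often as possible; an exchange argument shows that the sharing leaves enough
-- of the k colours for the edges xy.

open import Defs
open import Data.Nat using (ℕ; zero; suc; _+_; _*_; _∸_; _≤_; _<_; z≤n; s≤s)
open import Data.Nat.Properties
open import Data.Nat.Tactic.RingSolver using (solve-∀)
open import Data.Fin as Fin using (Fin; toℕ; fromℕ<)
open import Data.Fin.Properties as Finₚ using (toℕ<n; toℕ-fromℕ<; toℕ-injective; injective⇒≤)
open import Data.List using (List; []; _∷_; _++_; length; map; filter; take; allFin; lookup)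
open import Data.List.Properties using (length-++; length-map; length-take; filter-all; filter-++)
open import Data.List.Membership.Propositional using (_∈_; _∉_; find)
open import Data.List.Membership.Propositional.Properties using (∈-map⁺; ∈-++⁺ˡ; ∈-++⁺ʳ; ∈-++⁻; ∈-∃++; ∈-filter⁺; ∈-filter⁻; ∈-allFin)
import Data.List.Membership.DecPropositional as DecMembership
open import Data.List.Relation.Binary.Subset.Propositional using (_⊆_)
open import Data.List.Relation.Binary.Permutation.Propositional using (_↭_; ↭-refl; ↭-trans; ↭⇒↭ₛ; prep; swap)
open import Data.List.Relation.Binary.Permutation.Propositional.Properties using (All-resp-↭; ∈-resp-↭; ↭-length; shift)
import Data.List.Relation.Binary.Permutation.Propositional.Properties as Perm
import Data.List.Relation.Binary.Permutation.Setoid.Properties as PermSetoid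
open import Data.List.Relation.Unary.All as All using (All; []; _∷_)
open import Data.List.Relation.Unary.All.Properties as Allₚ using (all-filter)
open import Data.List.Relation.Unary.Any as Any using (here; there; index)
open import Data.List.Relation.Unary.Any.Properties using (lookup-index)
open import Data.List.Relation.Unary.AllPairs using ([]; _∷_)
open import Data.List.Relation.Unary.Unique.Propositional using (Unique)
import Data.List.Relation.Unary.Unique.Propositional.Properties as Uniqueₚ
open import Data.Product using (∃; ∃₂; _×_; _,_; proj₁; proj₂)
open import Data.Sum using (_⊎_; inj₁; inj₂; [_,_]′)
open import Data.Empty using (⊥; ⊥-elim)
open import Data.Bool using (true; false)
open import Function using (_∘_; id)
open import Relation.Binary.Construct.Closure.ReflexiveTransitive using (Star; ε; _◅_; _◅◅_; reverse)
open import Relation.Binary.PropositionalEquality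
open import Relation.Nullary using (¬_; Dec; yes; no; does; ¬?)
open import Relation.Nullary.Decidable using (_×-dec_; _⊎-dec_)
open import Relation.Binary.Definitions using (tri<; tri≈; tri>)
open import Relation.Unary using (Decidable)

-- Permutations, counting and the pigeonhole principle for lists.

when : {P A : Set} → Dec P → A → A → A
when (yes _) a b = a
when (no _)  a b = b

module _ {A : Set} where

  ∈⇒↭∷ : {a : A} {xs : List A} → a ∈ xs → ∃ λ ys → xs ↭ a ∷ ys
  ∈⇒↭∷ {a} a∈xs with ys , zs , refl ← ∈-∃++ a∈xs = ys ++ zs , shift a ys zs

  Unique-resp-↭ : {xs ys : List A} → xs ↭ ys → Unique xs → Unique ys
  Unique-resp-↭ p = PermSetoid.Unique-resp-↭ (setoid A) (↭⇒↭ₛ p)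

  length-filter-split : {P : A → Set} (P? : Decidable P) (xs : List A) →
    length xs ≡ length (filter P? xs) + length (filter (¬? ∘ P?) xs)
  length-filter-split P? [] = refl
  length-filter-split P? (x ∷ xs) with does (P? x)
  ... | true  = cong suc (length-filter-split P? xs)
  ... | false = trans (cong suc (length-filter-split P? xs)) (sym (+-suc _ _))

  length-pairs-≤ : {P : A → Set} (P? : Decidable P) {ps : List (A × A)} →
    All (λ p → P (proj₁ p) ⊎ P (proj₂ p)) ps →
    length ps ≤ length (filter P? (map proj₁ ps)) + length (filter P? (map proj₂ ps))
  length-pairs-≤ P? [] = z≤n
  length-pairs-≤ P? {(a , b) ∷ ps} (c ∷ cs) with P? a | P? b
  ... | yes _ | yes _ = s≤s (≤-trans (length-pairs-≤ P? cs) (+-monoʳ-≤ _ (n≤1+n _)))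
  ... | yes _ | no _ = s≤s (length-pairs-≤ P? cs)
  ... | no _ | yes _ = ≤-trans (s≤s (length-pairs-≤ P? cs)) (≤-reflexive (sym (+-suc _ _)))
  ... | no ¬a | no ¬b = ⊥-elim ([ ¬a , ¬b ]′ c)

  unique-⊆⇒length≤ : {xs ys : List A} → Unique xs → xs ⊆ ys → length xs ≤ length ys
  unique-⊆⇒length≤ [] sub = z≤n
  unique-⊆⇒length≤ {x ∷ xs} {ys} (x∉xs ∷ xs!) sub with zs , ys↭ ← ∈⇒↭∷ (sub (here refl)) =
    subst (suc (length xs) ≤_) (sym (↭-length ys↭)) (s≤s (unique-⊆⇒length≤ xs! sub′))
    where
    sub′ : xs ⊆ zs
    sub′ p with ∈-resp-↭ ys↭ (sub (there p))
    ... | here refl = ⊥-elim (All.lookup x∉xs p refl)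
    ... | there q = q

-- If every colour below `C` occurred in `L`, sending each to a position where it occurs would
-- inject `Fin C` into the positions of `L`.
∃-missing : (C : ℕ) (L : List ℕ) → length L < C → ∃ λ c → c < C × c ∉ L
∃-missing C L |L|<C with Finₚ.any? (λ (i : Fin C) → ¬? (DecMembership._∈?_ _≟_ (toℕ i) L))
... | yes (i , i∉L) = toℕ i , toℕ<n i , i∉L
... | no none = ⊥-elim (<⇒≱ |L|<C (injective⇒≤ {f = index ∘ mem} index-injective))
  where
  mem : (i : Fin C) → toℕ i ∈ L
  mem i with DecMembership._∈?_ _≟_ (toℕ i) L
  ... | yes p = p
  ... | no ¬p = ⊥-elim (none (i , ¬p))
  index-injective : ∀ {i j} → index (mem i) ≡ index (mem j) → i ≡ j
  index-injective {i} {j} eq = toℕ-injective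
    (trans (lookup-index (mem i)) (trans (cong (lookup L) eq) (sym (lookup-index (mem j)))))

-- Connected components of a decidable relation.

module Reachability {n : ℕ} {K : Fin n → Fin n → Set} (K? : ∀ u v → Dec (K u v)) (r : Fin n) where

  open DecMembership (Fin._≟_ {n}) using (_∈?_)

  -- `us` contains every vertex that `vs` still lacks and loses one whenever `vs` gains one, so its
  -- length bounds the number of extensions.
  grow : (fuel : ℕ) (vs us : List (Fin n)) → length us ≤ fuel →
    (∀ w → w ∈ vs ⊎ w ∈ us) → r ∈ vs → (∀ {w} → w ∈ vs → Star K r w) →
    ∃ λ S → r ∈ S × (∀ {u w} → u ∈ S → K u w → w ∈ S) × (∀ {w} → w ∈ S → Star K r w)
  grow fuel vs us |us|≤ cover r∈vs reach
    with Finₚ.any? (λ u → Finₚ.any? λ w → (u ∈? vs) ×-dec (¬? (w ∈? vs)) ×-dec K? u w)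
  ... | no closed = vs , r∈vs , closed′ , reach
    where
    closed′ : ∀ {u w} → u ∈ vs → K u w → w ∈ vs
    closed′ {u} {w} u∈ k with w ∈? vs
    ... | yes p = p
    ... | no ¬p = ⊥-elim (closed (u , w , u∈ , ¬p , k))
  ... | yes (u , w , u∈ , w∉ , k) with cover w
  ...   | inj₁ w∈ = ⊥-elim (w∉ w∈)
  ...   | inj₂ w∈us with us′ , us↭ ← ∈⇒↭∷ w∈us with fuel
  ...     | zero = ⊥-elim (n≮0 (subst (_≤ 0) (↭-length us↭) |us|≤))
  ...     | suc fuel′ = grow fuel′ (w ∷ vs) us′ (≤-pred (subst (_≤ suc fuel′) (↭-length us↭) |us|≤))
              cover′ (there r∈vs) reach′
    where
    cover′ : ∀ v → v ∈ w ∷ vs ⊎ v ∈ us′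
    cover′ v with cover v
    ... | inj₁ v∈ = inj₁ (there v∈)
    ... | inj₂ v∈ with ∈-resp-↭ us↭ v∈
    ...   | here v≡w = inj₁ (here v≡w)
    ...   | there v∈us′ = inj₂ v∈us′
    reach′ : ∀ {v} → v ∈ w ∷ vs → Star K r v
    reach′ (here refl) = reach u∈ ◅◅ (k ◅ ε)
    reach′ (there v∈) = reach v∈

  component : ∃ λ S → r ∈ S × (∀ {u w} → u ∈ S → K u w → w ∈ S) × (∀ {w} → w ∈ S → Star K r w)
  component = grow (length (allFin n)) (r ∷ []) (allFin n) ≤-refl (λ w → inj₂ (∈-allFin w)) (here refl)
    λ { (here refl) → ε }

-- Partial edge colourings and their extension.

module EdgeColouring (G : Multigraph) where

  E = Fin (m G)
  W = Fin (n G)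

  open DecMembership (Fin._≟_ {m G}) using (_∈?_)

  Inc : W → E → Set
  Inc = Incident G

  Inc? : ∀ v e → Dec (Inc v e)
  Inc? v e = (v Fin.≟ proj₁ (ends G e)) ⊎-dec (v Fin.≟ proj₂ (ends G e))

  Link : W → W → E → Set
  Link u v e = u ≢ v × Inc u e × Inc v e

  link-ends : ∀ {u v w e} → Link u v e → Inc w e → w ≡ u ⊎ w ≡ v
  link-ends (u≢v , inj₁ p , inj₁ q) i = ⊥-elim (u≢v (trans p (sym q)))
  link-ends (u≢v , inj₂ p , inj₂ q) i = ⊥-elim (u≢v (trans p (sym q)))
  link-ends (u≢v , inj₁ p , inj₂ q) (inj₁ i) = inj₁ (trans i (sym p))
  link-ends (u≢v , inj₁ p , inj₂ q) (inj₂ i) = inj₂ (trans i (sym q))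
  link-ends (u≢v , inj₂ p , inj₁ q) (inj₁ i) = inj₂ (trans i (sym q))
  link-ends (u≢v , inj₂ p , inj₁ q) (inj₂ i) = inj₁ (trans i (sym p))

  link-sym : ∀ {u v e} → Link u v e → Link v u e
  link-sym (u≢v , p , q) = u≢v ∘ sym , q , p

  other-end : ∀ {u e} → Inc u e → ∃ λ v → Link u v e
  other-end {u} {e} (inj₁ p) = proj₂ (ends G e) , (λ q → loopless G e (trans (sym p) q)) , inj₁ p , inj₂ refl
  other-end {u} {e} (inj₂ p) = proj₁ (ends G e) , (λ q → loopless G e (trans (sym q) p)) , inj₂ p , inj₁ refl

  -- Only the edges outside the list R are coloured; the values of φ on R are junk.
  record Proper (C : ℕ) (R : List E) (φ : E → ℕ) : Set where
    field
      bound : ∀ {e} → e ∉ R → φ e < C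
      inj   : ∀ {v e f} → e ∉ R → f ∉ R → Inc v e → Inc v f → φ e ≡ φ f → e ≡ f
  open Proper

  Misses : List E → (E → ℕ) → W → ℕ → Set
  Misses R φ v c = ∀ {e} → e ∉ R → Inc v e → φ e ≢ c

  weaken : ∀ {C D R T φ} → C ≤ D → R ⊆ T → Proper C R φ → Proper D T φ
  weaken C≤D R⊆T P .bound e∉ = ≤-trans (P .bound (e∉ ∘ R⊆T)) C≤D
  weaken C≤D R⊆T P .inj e∉ f∉ = P .inj (e∉ ∘ R⊆T) (f∉ ∘ R⊆T)

  ∉-∷ : ∀ {e f : E} {R} → f ≢ e → f ∉ R → f ∉ e ∷ R
  ∉-∷ f≢e f∉R (here p) = f≢e p
  ∉-∷ f≢e f∉R (there p) = f∉R p

  _[_≔_] : (E → ℕ) → E → ℕ → E → ℕ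
  (φ [ e ≔ c ]) f = when (f Fin.≟ e) c (φ f)

  insert : ∀ {C R φ e c} → Proper C (e ∷ R) φ → c < C →
    (∀ {v} → Inc v e → Misses (e ∷ R) φ v c) → Proper C R (φ [ e ≔ c ])
  insert {e = e} P c<C free .bound {f} f∉ with f Fin.≟ e
  ... | yes _ = c<C
  ... | no f≢e = P .bound (∉-∷ f≢e f∉)
  insert {e = e} P c<C free .inj {v} {f} {g} f∉ g∉ vf vg eq with f Fin.≟ e | g Fin.≟ e
  ... | yes refl | yes refl = refl
  ... | yes refl | no g≢e = ⊥-elim (free vf (∉-∷ g≢e g∉) vg (sym eq))
  ... | no f≢e | yes refl = ⊥-elim (free vg (∉-∷ f≢e f∉) vf eq)
  ... | no f≢e | no g≢e = P .inj (∉-∷ f≢e f∉) (∉-∷ g≢e g∉) vf vg eq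

  insert-fresh : ∀ {C R φ e} → Proper C (e ∷ R) φ → Proper (suc C) R (φ [ e ≔ C ])
  insert-fresh {C} P = insert (weaken (n≤1+n C) id P) ≤-refl λ _ f∉ _ eq → <⇒≢ (P .bound f∉) eq

  -- The fresh colour C goes to the edge xz and to the γ-edge at y, which frees γ for xy.
  insert-pair : ∀ {C R φ x y z g e γ} → Proper C (g ∷ e ∷ R) φ → Link x y g → Link x z e →
    γ < C → Misses (g ∷ e ∷ R) φ x γ →
    (∀ {f} → f ∉ g ∷ e ∷ R → Inc y f → Inc z f → φ f ≢ γ) →
    ∃ λ φ′ → Proper (suc C) R φ′
  insert-pair {C} {R} {φ} {x} {y} {z} {g} {e} {γ} P xyg xze γ<C xγ yzγ =
    φ′ , record { bound = λ f∉ → bound′ f∉ (view _)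
                ; inj = λ f∉ h∉ vf vh → inj′ f∉ h∉ vf vh (view _) (view _) }
    where
    T = g ∷ e ∷ R
    φ′ : E → ℕ
    φ′ f = when (f Fin.≟ g) γ (when (f Fin.≟ e) C (when (Inc? y f ×-dec (φ f ≟ γ)) C (φ f)))

    -- Indexing by the colour lets a match on `view f` reveal the value `φ′ f` along with the clause
    -- that produced it, so that properness becomes a check of pairs of clauses.
    data View (f : E) : ℕ → Set where
      is-g  : f ≡ g → View f γ
      is-e  : f ≡ e → View f C
      moved : f ≢ g → f ≢ e → Inc y f → φ f ≡ γ → View f C
      kept  : f ≢ g → f ≢ e → ¬ (Inc y f × φ f ≡ γ) → View f (φ f)

    view : ∀ f → View f (φ′ f)
    view f with f Fin.≟ g
    ... | yes p = is-g p
    ... | no f≢g with f Fin.≟ e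
    ...   | yes p = is-e p
    ...   | no f≢e with Inc? y f ×-dec (φ f ≟ γ)
    ...     | yes (yf , p) = moved f≢g f≢e yf p
    ...     | no ¬p = kept f≢g f≢e ¬p

    ∉T : ∀ {f} → f ∉ R → f ≢ g → f ≢ e → f ∉ T
    ∉T f∉ f≢g f≢e = ∉-∷ f≢g (∉-∷ f≢e f∉)

    bound′ : ∀ {f c} → f ∉ R → View f c → c < suc C
    bound′ f∉ (is-g _) = m<n⇒m<1+n γ<C
    bound′ f∉ (is-e _) = ≤-refl
    bound′ f∉ (moved _ _ _ _) = ≤-refl
    bound′ f∉ (kept p q _) = m<n⇒m<1+n (P .bound (∉T f∉ p q))

    -- An edge moved to colour `C` was a `γ`-edge at `y`. It cannot meet `e` at `x`, where `γ` is
    -- missing, nor at `z`, since no `γ`-edge joins `y` and `z`.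
    e-moved : ∀ {v h} → h ∉ T → Inc v e → Inc v h → Inc y h → φ h ≡ γ → ⊥
    e-moved h∉ ve vh yh c with link-ends xze ve
    ... | inj₁ refl = xγ h∉ vh c
    ... | inj₂ refl = yzγ h∉ yh vh c

    -- A `γ`-edge that keeps its colour meets `g` neither at `x`, where `γ` is missing, nor at `y`,
    -- where the `γ`-edge has been moved.
    g-kept : ∀ {v h} → h ∉ T → Inc v g → Inc v h → ¬ (Inc y h × φ h ≡ γ) → γ ≡ φ h → ⊥
    g-kept h∉ vg vh ¬c eq with link-ends xyg vg
    ... | inj₁ refl = xγ h∉ vh (sym eq)
    ... | inj₂ refl = ¬c (vh , sym eq)

    inj′ : ∀ {v f h c d} → f ∉ R → h ∉ R → Inc v f → Inc v h → View f c → View h d → c ≡ d → f ≡ h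
    inj′ f∉ h∉ vf vh (is-g p) (is-g q) eq = trans p (sym q)
    inj′ f∉ h∉ vf vh (is-g p) (is-e q) eq = ⊥-elim (<⇒≢ γ<C eq)
    inj′ f∉ h∉ vf vh (is-g p) (moved _ _ _ _) eq = ⊥-elim (<⇒≢ γ<C eq)
    inj′ f∉ h∉ vf vh (is-g refl) (kept a b c) eq = ⊥-elim (g-kept (∉T h∉ a b) vf vh c eq)
    inj′ f∉ h∉ vf vh (is-e p) (is-g q) eq = ⊥-elim (<⇒≢ γ<C (sym eq))
    inj′ f∉ h∉ vf vh (is-e p) (is-e q) eq = trans p (sym q)
    inj′ f∉ h∉ vf vh (is-e refl) (moved a b c d) eq = ⊥-elim (e-moved (∉T h∉ a b) vf vh c d)
    inj′ f∉ h∉ vf vh (is-e p) (kept a b c) eq = ⊥-elim (<⇒≢ (P .bound (∉T h∉ a b)) (sym eq))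
    inj′ f∉ h∉ vf vh (moved _ _ _ _) (is-g q) eq = ⊥-elim (<⇒≢ γ<C (sym eq))
    inj′ f∉ h∉ vf vh (moved a b c d) (is-e refl) eq = ⊥-elim (e-moved (∉T f∉ a b) vh vf c d)
    inj′ f∉ h∉ vf vh (moved a b c d) (moved a′ b′ c′ d′) eq =
      P .inj (∉T f∉ a b) (∉T h∉ a′ b′) c c′ (trans d (sym d′))
    inj′ f∉ h∉ vf vh (moved _ _ _ _) (kept a b c) eq = ⊥-elim (<⇒≢ (P .bound (∉T h∉ a b)) (sym eq))
    inj′ f∉ h∉ vf vh (kept a b c) (is-g refl) eq = ⊥-elim (g-kept (∉T f∉ a b) vh vf c (sym eq))
    inj′ f∉ h∉ vf vh (kept a b c) (is-e q) eq = ⊥-elim (<⇒≢ (P .bound (∉T f∉ a b)) eq)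
    inj′ f∉ h∉ vf vh (kept a b c) (moved _ _ _ _) eq = ⊥-elim (<⇒≢ (P .bound (∉T f∉ a b)) eq)
    inj′ f∉ h∉ vf vh (kept a b _) (kept a′ b′ _) eq = P .inj (∉T f∉ a b) (∉T h∉ a′ b′) vf vh eq

  -- Kempe chains.

  module Kempe {C T φ} (P : Proper C T φ) {β γ : ℕ} (β<C : β < C) (γ<C : γ < C) (β≢γ : β ≢ γ) where

    Step : ℕ → W → W → Set
    Step c u v = ∃ λ f → f ∉ T × Link u v f × φ f ≡ c

    Linked : W → W → Set
    Linked u v = Step β u v ⊎ Step γ u v

    step? : ∀ c u v → Dec (Step c u v)
    step? c u v = Finₚ.any? λ f → ¬? (f ∈? T) ×-dec (¬? (u Fin.≟ v) ×-dec Inc? u f ×-dec Inc? v f) ×-dec (φ f ≟ c)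

    linked? : ∀ u v → Dec (Linked u v)
    linked? u v = step? β u v ⊎-dec step? γ u v

    step-sym : ∀ {c u v} → Step c u v → Step c v u
    step-sym (f , f∉ , l , c) = f , f∉ , link-sym l , c

    linked-sym : ∀ {u v} → Linked u v → Linked v u
    linked-sym (inj₁ s) = inj₁ (step-sym s)
    linked-sym (inj₂ s) = inj₂ (step-sym s)

    step-functional : ∀ {c u v w} → Step c u v → Step c u w → v ≡ w
    step-functional (f , f∉ , l@(_ , uf , vf) , c) (h , h∉ , l′@(u≢w , uh , wh) , d)
      with refl ← P .inj f∉ h∉ uf uh (trans c (sym d)) with link-ends l wh
    ... | inj₁ w≡u = ⊥-elim (u≢w (sym w≡u))
    ... | inj₂ w≡v = sym w≡v

    sw : ℕ → ℕ
    sw c = when (c ≟ β) γ (when (c ≟ γ) β c)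

    sw-β : ∀ {c} → c ≡ β → sw c ≡ γ
    sw-β {c} p with c ≟ β
    ... | yes _ = refl
    ... | no ¬p = ⊥-elim (¬p p)

    sw-γ : ∀ {c} → c ≡ γ → sw c ≡ β
    sw-γ {c} p with c ≟ β
    ... | yes q = ⊥-elim (β≢γ (trans (sym q) p))
    ... | no _ with c ≟ γ
    ...   | yes _ = refl
    ...   | no ¬p = ⊥-elim (¬p p)

    sw-other : ∀ {c} → c ≢ β → c ≢ γ → sw c ≡ c
    sw-other {c} p q with c ≟ β
    ... | yes r = ⊥-elim (p r)
    ... | no _ with c ≟ γ
    ...   | yes r = ⊥-elim (q r)
    ...   | no _ = refl

    sw-involutive : ∀ c → sw (sw c) ≡ c
    sw-involutive c with c ≟ β
    ... | yes p = trans (sw-γ refl) (sym p)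
    ... | no ¬p with c ≟ γ
    ...   | yes q = trans (sw-β refl) (sym q)
    ...   | no ¬q = sw-other ¬p ¬q

    sw-bound : ∀ {c} → c < C → sw c < C
    sw-bound {c} c<C with c ≟ β
    ... | yes p = γ<C
    ... | no ¬p with c ≟ γ
    ...   | yes q = β<C
    ...   | no ¬q = c<C

    module Swap (S : List W) (closed : ∀ {u w} → u ∈ S → Linked u w → w ∈ S) where

      open DecMembership (Fin._≟_ {n G}) using () renaming (_∈?_ to _∈ᵂ?_)

      -- Testing one end is enough: as `S` is closed, a coloured edge of colour `β` or `γ` has both
      -- ends in `S` or neither, and `sw` fixes every other colour.
      swapped : E → ℕ
      swapped f = when (proj₁ (ends G f) ∈ᵂ? S) (sw (φ f)) (φ f)

      private
        linked : ∀ {u v f} → f ∉ T → Link u v f → φ f ≡ β ⊎ φ f ≡ γ → Linked u v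
        linked f∉ l (inj₁ p) = inj₁ (_ , f∉ , l , p)
        linked f∉ l (inj₂ p) = inj₂ (_ , f∉ , l , p)

        transfer : ∀ {u v f} → f ∉ T → Inc u f → Inc v f → φ f ≡ β ⊎ φ f ≡ γ → u ∈ S → v ∈ S
        transfer {u} {v} f∉ uf vf c u∈ with u Fin.≟ v
        ... | yes refl = u∈
        ... | no u≢v = closed u∈ (linked f∉ (u≢v , uf , vf) c)

        first : ∀ f → Inc (proj₁ (ends G f)) f
        first f = inj₁ refl

      swapped-in : ∀ {v f} → f ∉ T → Inc v f → v ∈ S → swapped f ≡ sw (φ f)
      swapped-in {v} {f} f∉ vf v∈ with proj₁ (ends G f) ∈ᵂ? S
      ... | yes _ = refl
      ... | no ∉S = sym (sw-other (λ p → ∉S (transfer f∉ vf (first f) (inj₁ p) v∈))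
                                  (λ p → ∉S (transfer f∉ vf (first f) (inj₂ p) v∈)))

      swapped-out : ∀ {v f} → f ∉ T → Inc v f → v ∉ S → swapped f ≡ φ f
      swapped-out {v} {f} f∉ vf v∉ with proj₁ (ends G f) ∈ᵂ? S
      ... | no _ = refl
      ... | yes ∈S = sw-other (λ p → v∉ (transfer f∉ (first f) vf (inj₁ p) ∈S))
                              (λ p → v∉ (transfer f∉ (first f) vf (inj₂ p) ∈S))

      proper : Proper C T swapped
      proper .bound {f} f∉ with proj₁ (ends G f) ∈ᵂ? S
      ... | yes _ = sw-bound (P .bound f∉)
      ... | no _ = P .bound f∉
      proper .inj {v} {e} {f} e∉ f∉ ve vf eq with v ∈ᵂ? S
      ... | yes v∈ = P .inj e∉ f∉ ve vf
            (trans (sym (sw-involutive _)) (trans (cong sw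
              (trans (sym (swapped-in e∉ ve v∈)) (trans eq (swapped-in f∉ vf v∈)))) (sw-involutive _)))
      ... | no v∉ = P .inj e∉ f∉ ve vf
            (trans (sym (swapped-out e∉ ve v∉)) (trans eq (swapped-out f∉ vf v∉)))

    -- An alternating walk from a vertex missing β has to start with γ.
    col : ℕ → ℕ
    col 0 = γ
    col 1 = β
    col (suc (suc i)) = col i

    col-alternates : ∀ i → (col i ≡ γ × col (suc i) ≡ β) ⊎ (col i ≡ β × col (suc i) ≡ γ)
    col-alternates zero = inj₁ (refl , refl)
    col-alternates (suc zero) = inj₂ (refl , refl)
    col-alternates (suc (suc i)) = col-alternates i

    data Walk (x : W) : ℕ → W → Set where
      start  : Walk x 0 x
      extend : ∀ {i u v} → Walk x i u → Step (col i) u v → Walk x (suc i) v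

    -- Each colour occurs at most once at a vertex, so the length of a walk determines its end. This
    -- takes the place of any argument about repeated vertices.
    walk-functional : ∀ {x i u v} → Walk x i u → Walk x i v → u ≡ v
    walk-functional start start = refl
    walk-functional (extend p s) (extend q t) with refl ← walk-functional p q = step-functional s t

    no-β : ∀ {x v} → Misses T φ x β → ¬ Step β x v
    no-β miss (f , f∉ , (_ , xf , _) , c) = miss f∉ xf c

    -- At the end of a walk, a link in the colour of the last step retraces that step, and one in
    -- the other colour extends the walk; at `x` itself only `γ` occurs.
    walk-linked : ∀ {x i u v} → Misses T φ x β → Walk x i u → Linked u v → ∃ λ j → Walk x j v
    walk-linked miss start (inj₁ s) = ⊥-elim (no-β miss s)
    walk-linked miss start (inj₂ s) = 1 , extend start s
    walk-linked miss w@(extend {i} p t) l with col-alternates i | l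
    ... | inj₁ (a , b) | inj₁ s = _ , extend w (subst (λ c → Step c _ _) (sym b) s)
    ... | inj₁ (a , b) | inj₂ s with refl ← step-functional (step-sym t) (subst (λ c → Step c _ _) (sym a) s) = _ , p
    ... | inj₂ (a , b) | inj₂ s = _ , extend w (subst (λ c → Step c _ _) (sym b) s)
    ... | inj₂ (a , b) | inj₁ s with refl ← step-functional (step-sym t) (subst (λ c → Step c _ _) (sym a) s) = _ , p

    walk-star : ∀ {x i u v} → Misses T φ x β → Walk x i u → Star Linked u v → ∃ λ j → Walk x j v
    walk-star miss w ε = _ , w
    walk-star miss w (l ◅ ls) = walk-star miss (proj₂ (walk-linked miss w l)) ls

    walk-prefix : ∀ {x i j u v} → Walk x i u → Walk x j v → i < j → ∃ λ w → Step (col i) u w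
    walk-prefix {i = i} p (extend {j} q t) (s≤s i≤j) with m≤n⇒m<n∨m≡n i≤j
    ... | inj₁ i<j = walk-prefix p q i<j
    ... | inj₂ refl with refl ← walk-functional p q = _ , t

    -- A nonempty walk enters a vertex missing `β` by a `γ`-step, and the next step would then have
    -- colour `β`.
    walk-stops : ∀ {x i y w} → x ≢ y → Misses T φ y β → Walk x i y → ¬ Step (col i) y w
    walk-stops x≢y miss start s = x≢y refl
    walk-stops x≢y miss (extend {i} p t) s with col-alternates i
    ... | inj₁ (a , b) = no-β miss (subst (λ c → Step c _ _) b s)
    ... | inj₂ (a , b) = no-β miss (subst (λ c → Step c _ _) a (step-sym t))

    -- Both `y` and `z` are reached by the walk from `x`. The one with the shorter walk would have
    -- to be left again, against `walk-stops`; equal lengths would give `y ≡ z`.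
    ¬-two-ends : ∀ {x y z} → x ≢ y → x ≢ z → y ≢ z →
      Misses T φ x β → Misses T φ y β → Misses T φ z β → Star Linked x y → Star Linked x z → ⊥
    ¬-two-ends x≢y x≢z y≢z mx my mz xy xz with walk-star mx start xy | walk-star mx start xz
    ... | i , p | j , q with <-cmp i j
    ...   | tri< i<j _ _ = walk-stops x≢y my p (proj₂ (walk-prefix p q i<j))
    ...   | tri≈ _ refl _ = y≢z (walk-functional p q)
    ...   | tri> _ _ j<i = walk-stops x≢z mz q (proj₂ (walk-prefix q p j<i))

  -- Colouring three sides of a triangle with one new colour.

  -- Exchanging `β` and `γ` on `S` makes `z` miss `γ`, while `x` and `y` still miss `β`. So `g` can
  -- take `β`, and `insert-pair` at `z` with `γ` colours `e` and `h`, as no `γ`-edge joins `x` and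
  -- `y`.
  insert-isolated : ∀ {C T R φ x y z g e h β γ} (P : Proper C T φ) → T ⊆ g ∷ e ∷ h ∷ R →
    Link x y g → Link x z e → Link y z h → (β<C : β < C) (γ<C : γ < C) (β≢γ : β ≢ γ) →
    Misses T φ x β → Misses T φ y β → Misses T φ z β →
    (∀ {f} → f ∉ T → Inc x f → Inc y f → φ f ≢ γ) →
    (S : List W) (closed : ∀ {u w} → u ∈ S → Kempe.Linked P β<C γ<C β≢γ u w → w ∈ S) →
    z ∈ S → x ∉ S → y ∉ S → ∃ λ φ′ → Proper (suc C) R φ′
  insert-isolated {C} {T} {R} {φ} {x} {y} {z} {g} {e} {h} {β} {γ} P sub xyg xze yzh β<C γ<C β≢γ mx my mz xyγ S closed z∈ x∉ y∉ =
    insert-pair P₂ (link-sym xze) (link-sym yzh) γ<C mz₂ xyγ₂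
    where
    open Kempe P β<C γ<C β≢γ
    open Swap S closed
    φ₁ = swapped
    φ₂ = φ₁ [ g ≔ β ]
    P₂ : Proper C (e ∷ h ∷ R) φ₂
    P₂ = insert (weaken ≤-refl sub proper) β<C free
      where
      free : ∀ {v} → Inc v g → Misses (g ∷ e ∷ h ∷ R) φ₁ v β
      free vg f∉ vf eq with link-ends xyg vg
      ... | inj₁ refl = mx (f∉ ∘ sub) vf (trans (sym (swapped-out (f∉ ∘ sub) vf x∉)) eq)
      ... | inj₂ refl = my (f∉ ∘ sub) vf (trans (sym (swapped-out (f∉ ∘ sub) vf y∉)) eq)
    mz₂ : Misses (e ∷ h ∷ R) φ₂ z γ
    mz₂ {f} f∉ zf eq with f Fin.≟ g
    ... | yes refl = β≢γ eq
    ... | no f≢g = mz f∉T zf (trans (sym (sw-involutive _)) (trans (cong sw (trans (sym (swapped-in f∉T zf z∈)) eq)) (sw-γ refl)))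
      where f∉T = ∉-∷ f≢g f∉ ∘ sub
    xyγ₂ : ∀ {f} → f ∉ e ∷ h ∷ R → Inc x f → Inc y f → φ₂ f ≢ γ
    xyγ₂ {f} f∉ xf yf eq with f Fin.≟ g
    ... | yes refl = β≢γ eq
    ... | no f≢g = xyγ f∉T xf yf (trans (sym (swapped-out f∉T xf x∉)) eq)
      where f∉T = ∉-∷ f≢g f∉ ∘ sub

  InTriangle : W → W → W → E → Set
  InTriangle x y z f = (Inc x f × Inc y f) ⊎ (Inc x f × Inc z f) ⊎ (Inc y f × Inc z f)

  inTriangle? : ∀ x y z f → Dec (InTriangle x y z f)
  inTriangle? x y z f = (Inc? x f ×-dec Inc? y f) ⊎-dec (Inc? x f ×-dec Inc? z f) ⊎-dec (Inc? y f ×-dec Inc? z f)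

  -- A (β,γ)-component has at most two ends, so that of one of x, y, z avoids the other two
  -- vertices; after swapping it, the edge opposite to that vertex can take β.
  insert-triangle : ∀ {C T R φ x y z g e h β γ} → Proper C T φ → T ⊆ g ∷ e ∷ h ∷ R →
    Link x y g → Link x z e → Link y z h → β < C → γ < C → β ≢ γ →
    Misses T φ x β → Misses T φ y β → Misses T φ z β →
    (∀ {f} → f ∉ T → InTriangle x y z f → φ f ≢ γ) →
    ∃ λ φ′ → Proper (suc C) R φ′
  insert-triangle {C} {T} {R} {φ} {x} {y} {z} {g} {e} {h} P sub xyg@(x≢y , _) xze@(x≢z , _) yzh@(y≢z , _) β<C γ<C β≢γ mx my mz tri
    = by-component (component x)
    where
    open Kempe P β<C γ<C β≢γ
    open Reachability linked?
    open DecMembership (Fin._≟_ {n G}) using () renaming (_∈?_ to _∈ᵂ?_)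
    back : ∀ {u v} → Star Linked u v → Star Linked v u
    back = reverse linked-sym
    rotate₁ : g ∷ e ∷ h ∷ R ⊆ h ∷ g ∷ e ∷ R
    rotate₁ (here p) = there (here p)
    rotate₁ (there (here p)) = there (there (here p))
    rotate₁ (there (there (here p))) = here p
    rotate₁ (there (there (there p))) = there (there (there p))
    rotate₂ : g ∷ e ∷ h ∷ R ⊆ e ∷ g ∷ h ∷ R
    rotate₂ (here p) = there (here p)
    rotate₂ (there (here p)) = here p
    rotate₂ (there (there p)) = there (there p)
    by-component : (∃ λ S → x ∈ S × (∀ {u w} → u ∈ S → Linked u w → w ∈ S) × (∀ {w} → w ∈ S → Star Linked x w)) →
      ∃ λ φ′ → Proper (suc C) R φ′
    by-component (S , x∈ , closed , reach) with y ∈ᵂ? S | z ∈ᵂ? S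
    ... | yes y∈ | _ with S′ , z∈ , closed′ , reach′ ← component z =
      insert-isolated P sub xyg xze yzh β<C γ<C β≢γ mx my mz (λ f∉ xf yf → tri f∉ (inj₁ (xf , yf))) S′ closed′ z∈
        (λ x∈′ → ¬-two-ends x≢y x≢z y≢z mx my mz (reach y∈) (back (reach′ x∈′)))
        (λ y∈′ → ¬-two-ends (x≢y ∘ sym) y≢z x≢z my mx mz (back (reach y∈)) (back (reach′ y∈′)))
    ... | no y∉ | yes z∈ with S′ , y∈ , closed′ , reach′ ← component y =
      insert-isolated P (rotate₂ ∘ sub) xze xyg (link-sym yzh) β<C γ<C β≢γ mx mz my (λ f∉ xf zf → tri f∉ (inj₂ (inj₁ (xf , zf)))) S′ closed′ y∈
        (λ x∈′ → ¬-two-ends x≢y x≢z y≢z mx my mz (back (reach′ x∈′)) (reach z∈))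
        (λ z∈′ → ¬-two-ends (x≢z ∘ sym) (y≢z ∘ sym) x≢y mz mx my (back (reach z∈)) (back (reach′ z∈′)))
    ... | no y∉ | no z∉ =
      insert-isolated P (rotate₁ ∘ sub) yzh (link-sym xyg) (link-sym xze) β<C γ<C β≢γ my mz mx (λ f∉ yf zf → tri f∉ (inj₂ (inj₂ (yf , zf)))) S closed x∈ y∉ z∉

  -- Missing colours, fresh colours and greedy colouring.

  -- `R` and the coloured edges satisfying `Q` are disjoint and together at most `k`, hence fewer
  -- than `C + length R`; so fewer than `C` coloured edges satisfy `Q`.
  free-colour : ∀ {C R k} {Q : E → Set} (Q? : ∀ e → Dec (Q e)) (φ : E → ℕ) →
    (∀ L → Unique L → All Q L → length L ≤ k) → Unique R → All Q R → k < C + length R →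
    ∃ λ c → c < C × (∀ {f} → f ∉ R → Q f → φ f ≢ c)
  free-colour {C} {R} {k} {Q} Q? φ small R! QR k< with ∃-missing C (map φ L) |L|<C
    where
    D? = λ f → ¬? (f ∈? R) ×-dec Q? f
    L = filter D? (allFin (m G))
    |R++L|≤k : length (R ++ L) ≤ k
    |R++L|≤k = small (R ++ L)
      (Uniqueₚ.++⁺ R! (Uniqueₚ.filter⁺ D? (Uniqueₚ.allFin⁺ _))
        (λ { (p , q) → proj₁ (proj₂ (∈-filter⁻ D? {xs = allFin _} q)) p }))
      (Allₚ.++⁺ QR (All.map proj₂ (all-filter D? (allFin _))))
    |L|<C : length (map φ L) < C
    |L|<C = +-cancelˡ-< (length R) _ _ (begin-strict
      length R + length (map φ L) ≡⟨ cong (length R +_) (length-map φ L) ⟩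
      length R + length L         ≡⟨ length-++ R ⟨
      length (R ++ L)             ≤⟨ |R++L|≤k ⟩
      k                           <⟨ k< ⟩
      C + length R                ≡⟨ +-comm C _ ⟩
      length R + C                ∎)
      where open ≤-Reasoning
  ... | c , c<C , c∉ = c , c<C , λ f∉ qf eq →
    c∉ (subst (_∈ _) eq (∈-map⁺ φ (∈-filter⁺ (λ f → ¬? (f ∈? R) ×-dec Q? f) (∈-allFin _) (f∉ , qf))))

  -- Before receiving `C`, the edge `b` is treated as uncoloured, so it may have had a colour
  -- already, which it gives up.
  insert-fresh-pair : ∀ {C R φ a b} → Proper C (a ∷ R) φ → (∀ {v} → Inc v a → ¬ Inc v b) →
    Proper (suc C) R ((φ [ b ≔ C ]) [ a ≔ C ])
  insert-fresh-pair {C} {R} {φ} {a} {b} P apart = insert (insert-fresh (weaken ≤-refl there P)) ≤-refl free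
    where
    free : ∀ {v} → Inc v a → Misses (a ∷ R) (φ [ b ≔ C ]) v C
    free va {f} f∉ vf eq with f Fin.≟ b
    ... | yes refl = apart va vf
    ... | no _ = <⇒≢ (P .bound f∉) eq

  -- Fewer than `d` other edges meet `e` at either end, so fewer than `d + d` colours are excluded
  -- for it.
  greedy : ∀ {k d} → d + d ≤ k → (∀ x L → Unique L → All (Inc x) L → length L ≤ d) →
    ∀ R {φ} → Proper k R φ → ∃ λ φ′ → Proper k [] φ′
  greedy 2d≤k small [] P = _ , P
  greedy {k} {d} 2d≤k small (e ∷ R) {φ} P = greedy 2d≤k small R (insert P (proj₁ (proj₂ colour)) free)
    where
    D? : ∀ u f → Dec (f ≢ e × Inc u f)
    D? u f = ¬? (f Fin.≟ e) ×-dec Inc? u f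
    nbrs : W → List E
    nbrs u = filter (D? u) (allFin (m G))
    |nbrs|<d : ∀ {u} → Inc u e → length (nbrs u) < d
    |nbrs|<d {u} ue = small u (e ∷ nbrs u)
      (All.map (λ p → proj₁ p ∘ sym) (all-filter (D? u) (allFin _)) ∷ Uniqueₚ.filter⁺ (D? u) (Uniqueₚ.allFin⁺ _))
      (ue ∷ All.map proj₂ (all-filter (D? u) (allFin _)))
    u = proj₁ (ends G e)
    v = proj₂ (ends G e)
    L = map φ (nbrs u ++ nbrs v)
    colour : ∃ λ c → c < k × c ∉ L
    colour = ∃-missing k L (begin-strict
      length L                          ≡⟨ trans (length-map φ (nbrs u ++ nbrs v)) (length-++ (nbrs u)) ⟩
      length (nbrs u) + length (nbrs v) <⟨ +-mono-< (|nbrs|<d (inj₁ refl)) (|nbrs|<d (inj₂ refl)) ⟩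
      d + d                             ≤⟨ 2d≤k ⟩
      k                                 ∎)
      where open ≤-Reasoning
    free : ∀ {w} → Inc w e → Misses (e ∷ R) φ w (proj₁ colour)
    free (inj₁ refl) f∉ wf eq = proj₂ (proj₂ colour) (subst (_∈ L) eq
      (∈-map⁺ φ (∈-++⁺ˡ (∈-filter⁺ (D? u) (∈-allFin _) (f∉ ∘ here , wf)))))
    free (inj₂ refl) f∉ wf eq = proj₂ (proj₂ colour) (subst (_∈ L) eq
      (∈-map⁺ φ (∈-++⁺ʳ (nbrs u) (∈-filter⁺ (D? v) (∈-allFin _) (f∉ ∘ here , wf)))))

  star : W → List E
  star x = filter (Inc? x) (allFin (m G))

  star-unique : ∀ x → Unique (star x)
  star-unique x = Uniqueₚ.filter⁺ (Inc? x) (Uniqueₚ.allFin⁺ _)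

  star-incident : ∀ x → All (Inc x) (star x)
  star-incident x = all-filter (Inc? x) (allFin _)

  ∈-star : ∀ {x e} → Inc x e → e ∈ star x
  ∈-star {x} xe = ∈-filter⁺ (Inc? x) (∈-allFin _) xe

  private-edges : W → W → List E
  private-edges x y = filter (¬? ∘ Inc? y) (star x)

  common-edges : W → W → List E
  common-edges x y = filter (Inc? y) (star x)

  -- Rounds that colour two edges at a vertex with one new colour.

  module Bounded (k : ℕ)
    (star≤k : ∀ x L → Unique L → All (Inc x) L → length L ≤ k)
    (triangle≤k : ∀ x y z L → Unique L → All (InTriangle x y z) L → length L ≤ k)
    (¬colourable : ∀ φ → ¬ Proper k [] φ) where

    -- The partner `e′` of `g` is chosen here, as `e` may have to be given up when a `β`-edge joins
    -- `y` to its other end. `R′` is quantified last because the edges left over are known only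
    -- after `e′`.
    star-step : ∀ {C R φ x y g e} → Proper C R φ → Unique R → All (Inc x) R → k < C + length R →
      Link x y g → e ∈ R → ¬ Inc y e →
      ∃ λ e′ → e′ ∈ R × ¬ Inc y e′ × (∀ {R′} → R ⊆ g ∷ e′ ∷ R′ → ∃ λ φ′ → Proper (suc C) R′ φ′)
    star-step {C} {R} {φ} {x} {y} {g} {e} P R! xR k< xyg e∈ ¬ye
      with β , β<C , xβ ← free-colour {C} (Inc? x) φ (star≤k x) R! xR k<
      with z , xze@(x≢z , _ , ze) ← other-end (All.lookup xR e∈)
      with Finₚ.any? (λ f → ¬? (f ∈? R) ×-dec Inc? y f ×-dec Inc? z f ×-dec (φ f ≟ β))
    ... | no none = e , e∈ , ¬ye , λ sub → insert-pair (weaken ≤-refl sub P) xyg xze β<C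
            (λ f∉ → xβ (f∉ ∘ sub)) (λ f∉ yf zf eq → none (_ , f∉ ∘ sub , yf , zf , eq))
    ... | yes (h , h∉ , yh , zh , hβ)
      with Finₚ.any? (λ f → (f ∈? R) ×-dec (¬? (Inc? y f)) ×-dec (¬? (Inc? z f)))
    ...   | yes (e′ , e′∈ , ¬ye′ , ¬ze′) with w , xwe′@(_ , _ , we′) ← other-end (All.lookup xR e′∈) =
            e′ , e′∈ , ¬ye′ , λ sub → insert-pair (weaken ≤-refl sub P) xyg xwe′ β<C
              (λ f∉ → xβ (f∉ ∘ sub)) (λ f∉ yf wf eq → no-yw we′ (f∉ ∘ sub) yf wf eq)
      where
      -- `h` is the only `β`-edge at `y`, and its other end `z` differs from `w`, since `e′` does
      -- not meet `z`.
      no-yw : ∀ {w f} → Inc w e′ → f ∉ R → Inc y f → Inc w f → φ f ≢ β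
      no-yw we′ f∉ yf wf eq with refl ← P .inj f∉ h∉ yf yh (trans eq (sym hβ))
        with link-ends ((λ { refl → ¬ye ze }) , yh , zh) wf
      ... | inj₁ refl = ¬ye′ we′
      ... | inj₂ refl = ¬ze′ we′
    -- Now every edge of `R` lies in the triangle. With `h` uncoloured too, all three vertices miss
    -- `β`, and the triangle bound supplies `γ`.
    ...   | no none = e , e∈ , ¬ye , λ sub →
            insert-triangle (weaken ≤-refl there P) (grow-h sub) xyg xze yzh β<C γ<C β≢γ
              (λ f∉ → xβ (f∉ ∘ there)) (only-h yh) (only-h zh) (λ f∉ → proj₂ (proj₂ free) (f∉ ∘ there))
      where
      yzh : Link y z h
      yzh = (λ { refl → ¬ye ze }) , yh , zh
      in-triangle : ∀ {f} → f ∈ R → InTriangle x y z f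
      in-triangle {f} f∈ with Inc? y f | Inc? z f
      ... | yes yf | _ = inj₁ (All.lookup xR f∈ , yf)
      ... | no _ | yes zf = inj₂ (inj₁ (All.lookup xR f∈ , zf))
      ... | no ¬yf | no ¬zf = ⊥-elim (none (f , f∈ , ¬yf , ¬zf))
      free : ∃ λ c → c < C × (∀ {f} → f ∉ R → InTriangle x y z f → φ f ≢ c)
      free = free-colour (inTriangle? x y z) φ (triangle≤k x y z) R! (All.tabulate in-triangle) k<
      γ<C = proj₁ (proj₂ free)
      β≢γ : β ≢ proj₁ free
      β≢γ eq = proj₂ (proj₂ free) h∉ (inj₂ (inj₂ (yh , zh))) (trans hβ eq)
      only-h : ∀ {v} → Inc v h → Misses (h ∷ R) φ v β
      only-h vh f∉ vf eq = f∉ (here (P .inj (f∉ ∘ there) h∉ vf vh (trans eq (sym hβ))))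
      grow-h : ∀ {R′} → R ⊆ g ∷ e ∷ R′ → h ∷ R ⊆ g ∷ e ∷ h ∷ R′
      grow-h sub (here p) = there (there (here p))
      grow-h sub (there p) with sub p
      ... | here q = here q
      ... | there (here q) = there (here q)
      ... | there (there q) = there (there (there q))

    ¬-few-uncoloured : ∀ {C} R {φ} → Proper C R φ → C + length R ≤ k → ⊥
    ¬-few-uncoloured {C} [] P C≤k = ¬colourable _ (weaken (subst (_≤ k) (+-identityʳ C) C≤k) id P)
    ¬-few-uncoloured {C} (e ∷ R) P C≤k = ¬-few-uncoloured R (insert-fresh P) (subst (_≤ k) (+-suc C _) C≤k)

    -- `r` counts the rounds to come. The invariant supplies `g` and `y`, but `star-step` picks the
    -- partner, so `Inv` has to survive the removal of any edge of `R₀` avoiding `y`.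
    Progress : W → (ℕ → List E → Set) → Set
    Progress x Inv = ∀ {r R} → Unique R → All (Inc x) R → Inv (suc r) R →
        ∃ λ g → ∃ λ R₀ → ∃ λ y → R ≡ g ∷ R₀ × Link x y g × (∃ λ e → e ∈ R₀ × ¬ Inc y e) ×
        (∀ {e} → e ∈ R₀ → ¬ Inc y e → ∃ λ R′ → R₀ ↭ e ∷ R′ × Inv r R′)

    module StarProcess (x : W) (Inv : ℕ → List E → Set)
      (next : Progress x Inv) where

      -- Each round adds one colour and removes two edges, so `C + length R` falls from `k + r` to
      -- `k`, where `¬-few-uncoloured` applies.
      run : ∀ r {C R φ} → Proper C R φ → Unique R → All (Inc x) R → Inv r R → C + length R ≡ k + r → ⊥
      run zero P R! xR inv eq = ¬-few-uncoloured _ P (≤-reflexive (trans eq (+-identityʳ k)))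
      run (suc r) {C} P R! xR inv eq with next R! xR inv
      ... | g , R₀ , y , refl , xyg@(_ , _ , yg) , (e , e∈ , ¬ye) , rest
        with star-step P R! xR (subst (k <_) (sym (trans eq (+-suc k r))) (s≤s (m≤m+n k r))) xyg (there e∈) ¬ye
      ...   | e′ , here refl , ¬ye′ , _ = ¬ye′ yg
      ...   | e′ , there e′∈ , ¬ye′ , colour with rest e′∈ ¬ye′
      ...     | R′ , R₀↭ , inv′ with Unique-resp-↭ (prep g R₀↭) R! | All-resp-↭ (prep g R₀↭) xR
      ...       | _ ∷ (_ ∷ R′!) | _ ∷ (_ ∷ xR′) =
        run r (proj₂ (colour (∈-resp-↭ (prep g R₀↭)))) R′! xR′ inv′ (suc-injective (begin
          suc (suc C + length R′)      ≡⟨ cong suc (+-suc C _) ⟨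
          suc (C + suc (length R′))    ≡⟨ +-suc C _ ⟨
          C + suc (suc (length R′))    ≡⟨ cong (λ l → C + suc l) (↭-length R₀↭) ⟨
          C + suc (length R₀)          ≡⟨ eq ⟩
          k + suc r                    ≡⟨ +-suc k r ⟩
          suc (k + r)                  ∎))
        where open ≡-Reasoning

    -- While rounds remain, the invariant guarantees more than `ℓ` uncoloured edges, so by the first
    -- hypothesis they do not all end at one neighbour. A round removes two edges, whence `r + r`;
    -- the `suc` reflects that the last round needs only `ℓ + 1` edges.
    spread-star : ∀ {C R φ x ℓ r} →
      (∀ {y} L → x ≢ y → Unique L → All (Inc x) L → All (Inc y) L → length L ≤ ℓ) →
      Proper C R φ → Unique R → All (Inc x) R → ℓ + (r + r) ≤ suc (length R) → C + length R ≡ k + r → ⊥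
    spread-star {x = x} {ℓ} {r} thin P R! xR big eq = run r P R! xR big eq
      where
      Inv : ℕ → List E → Set
      Inv r R = ℓ + (r + r) ≤ suc (length R)
      shrink : ∀ {r l} → ℓ + (suc r + suc r) ≤ suc (suc (suc l)) → ℓ + (r + r) ≤ suc l
      shrink {r} {l} p = ≤-pred (≤-pred (subst (_≤ suc (suc (suc l))) (begin
        ℓ + (suc r + suc r)         ≡⟨ cong (λ i → ℓ + suc i) (+-suc r r) ⟩
        ℓ + suc (suc (r + r))       ≡⟨ +-suc ℓ _ ⟩
        suc (ℓ + suc (r + r))       ≡⟨ cong suc (+-suc ℓ _) ⟩
        suc (suc (ℓ + (r + r)))     ∎) p))
        where open ≡-Reasoning
      ℓ< : ∀ {r l} → ℓ + (suc r + suc r) ≤ suc l → ℓ < l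
      ℓ< {r} {l} p = ≤-pred (≤-trans (begin
        suc (suc ℓ)                 ≤⟨ s≤s (s≤s (m≤m+n ℓ (r + r))) ⟩
        suc (suc (ℓ + (r + r)))     ≡⟨ cong suc (+-suc ℓ _) ⟨
        suc (ℓ + suc (r + r))       ≡⟨ +-suc ℓ _ ⟨
        ℓ + suc (suc (r + r))       ≡⟨ cong (λ i → ℓ + suc i) (+-suc r r) ⟨
        ℓ + (suc r + suc r)         ∎) p)
        where open ≤-Reasoning
      next : Progress x Inv
      next {r} {[]} R! xR inv = ⊥-elim (n≮0 (ℓ< {r} inv))
      next {r} {g ∷ R₀} R! (xg ∷ xR₀) inv with y , xyg@(x≢y , _ , yg) ← other-end xg
        with Finₚ.any? (λ e → (e ∈? R₀) ×-dec ¬? (Inc? y e))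
      ... | yes off = g , R₀ , y , refl , xyg , off , λ e∈ _ →
              proj₁ (∈⇒↭∷ e∈) , proj₂ (∈⇒↭∷ e∈) ,
              shrink {r} (subst (λ l → ℓ + (suc r + suc r) ≤ suc (suc l)) (↭-length (proj₂ (∈⇒↭∷ e∈))) inv)
      ... | no none = ⊥-elim (<⇒≱ (ℓ< {r} inv) (thin (g ∷ R₀) x≢y R! (xg ∷ xR₀) (yg ∷ All.tabulate on-y)))
        where
        on-y : ∀ {e} → e ∈ R₀ → Inc y e
        on-y {e} e∈ with Inc? y e
        ... | yes p = p
        ... | no ¬p = ⊥-elim (none (e , e∈ , ¬p))
      open StarProcess x Inv (λ {r} {R} → next {r} {R})

    -- The same `y` serves in all rounds: each takes `g` from `M`, and the partner found by
    -- `star-step` avoids `y` and so comes from `N`. Hence `r` edges of each kind last for `r`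
    -- rounds.
    split-star : ∀ {C M N φ x y r} → x ≢ y → Proper C (M ++ N) φ → Unique (M ++ N) → All (Inc x) (M ++ N) →
      All (Inc y) M → All (λ e → ¬ Inc y e) N → r ≤ length M → r ≤ length N →
      C + length (M ++ N) ≡ k + r → ⊥
    split-star {x = x} {y} {r} x≢y P R! xR yM ¬yN r≤M r≤N eq =
      run r P R! xR (_ , _ , refl , yM , ¬yN , r≤M , r≤N) eq
      where
      Inv : ℕ → List E → Set
      Inv r R = ∃₂ λ M N → R ≡ M ++ N × All (Inc y) M × All (λ e → ¬ Inc y e) N × r ≤ length M × r ≤ length N
      next : Progress x Inv
      next {r} R! (xg ∷ xR) (g ∷ M , N@(e ∷ _) , refl , yg ∷ yM , ¬yN@(¬ye ∷ _) , s≤s r≤M , r<N) =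
        g , M ++ N , y , refl , (x≢y , xg , yg) , (e , ∈-++⁺ʳ M (here refl) , ¬ye) , rest
        where
        rest : ∀ {e} → e ∈ M ++ N → ¬ Inc y e → ∃ λ R′ → M ++ N ↭ e ∷ R′ × Inv r R′
        rest {e} e∈ ¬ye with ∈-++⁻ M e∈
        ... | inj₁ e∈M = ⊥-elim (¬ye (All.lookup yM e∈M))
        ... | inj₂ e∈N with N′ , N↭ ← ∈⇒↭∷ e∈N with All-resp-↭ N↭ ¬yN
        ...   | _ ∷ ¬yN′ = M ++ N′ , ↭-trans (Perm.++⁺ˡ M N↭) (shift e M N′) ,
                M , N′ , refl , yM , ¬yN′ , r≤M , ≤-pred (subst (suc r ≤_) (↭-length N↭) r<N)
      open StarProcess x Inv (λ {r} {R} → next {r} {R})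

    -- Colouring the edges around a pair of vertices.

    module HeavyPair {x y : W} (x≢y : x ≢ y) where

      M A B : List E
      M = common-edges x y
      A = private-edges x y
      B = private-edges y x

      private
        M! : Unique M
        M! = Uniqueₚ.filter⁺ (Inc? y) (star-unique x)
        A! : Unique A
        A! = Uniqueₚ.filter⁺ (¬? ∘ Inc? y) (star-unique x)
        B! : Unique B
        B! = Uniqueₚ.filter⁺ (¬? ∘ Inc? x) (star-unique y)
        M-inc : All (λ e → Inc x e × Inc y e) M
        M-inc = All.zip (Allₚ.filter⁺ (Inc? y) (star-incident x) , all-filter (Inc? y) (star x))
        A-inc : All (λ e → Inc x e × ¬ Inc y e) A
        A-inc = All.zip (Allₚ.filter⁺ (¬? ∘ Inc? y) (star-incident x) , all-filter (¬? ∘ Inc? y) (star x))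
        B-inc : All (λ e → Inc y e × ¬ Inc x e) B
        B-inc = All.zip (Allₚ.filter⁺ (¬? ∘ Inc? x) (star-incident y) , all-filter (¬? ∘ Inc? x) (star y))

        A++M≤k : length A + length M ≤ k
        A++M≤k = subst (_≤ k) (length-++ A) (star≤k x (A ++ M)
          (Uniqueₚ.++⁺ A! M! λ { (p , q) → proj₂ (All.lookup A-inc p) (proj₂ (All.lookup M-inc q)) })
          (Allₚ.++⁺ (All.map proj₁ A-inc) (All.map proj₁ M-inc)))

        B++M≤k : length B + length M ≤ k
        B++M≤k = subst (_≤ k) (length-++ B) (star≤k y (B ++ M)
          (Uniqueₚ.++⁺ B! M! λ { (p , q) → proj₂ (All.lookup B-inc p) (proj₁ (All.lookup M-inc q)) })
          (Allₚ.++⁺ (All.map proj₁ B-inc) (All.map proj₂ M-inc)))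

        triangle-count : ∀ z → length (filter (Inc? z) A) + (length (filter (Inc? z) B) + length M) ≤ k
        triangle-count z = subst (_≤ k) (trans (length-++ FA) (cong (length FA +_) (length-++ FB)))
          (triangle≤k x y z (FA ++ (FB ++ M))
            (Uniqueₚ.++⁺ (Uniqueₚ.filter⁺ (Inc? z) A!)
              (Uniqueₚ.++⁺ (Uniqueₚ.filter⁺ (Inc? z) B!) M!
                λ { (p , q) → proj₂ (All.lookup FB-inc p) (proj₁ (All.lookup M-inc q)) })
              λ { (p , q) → [ (λ r → proj₂ (All.lookup FB-inc r) (proj₁ (All.lookup FA-inc p)))
                            , (λ r → proj₂ (All.lookup FA-inc p) (proj₂ (All.lookup M-inc r))) ]′ (∈-++⁻ FB q) })
            (Allₚ.++⁺ (All.map (λ { ((a , _) , c) → inj₂ (inj₁ (a , c)) }) (All.zip (FA-inc , all-filter (Inc? z) A)))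
              (Allₚ.++⁺ (All.map (λ { ((a , _) , c) → inj₂ (inj₂ (a , c)) }) (All.zip (FB-inc , all-filter (Inc? z) B)))
                (All.map inj₁ M-inc))))
          where
          FA = filter (Inc? z) A
          FB = filter (Inc? z) B
          FA-inc : All (λ e → Inc x e × ¬ Inc y e) FA
          FA-inc = Allₚ.filter⁺ (Inc? z) A-inc
          FB-inc : All (λ e → Inc y e × ¬ Inc x e) FB
          FB-inc = Allₚ.filter⁺ (Inc? z) B-inc

      Share : E → E → Set
      Share a b = ∃ λ v → Inc v a × Inc v b

      share? : ∀ a b → Dec (Share a b)
      share? a b = Finₚ.any? λ v → Inc? v a ×-dec Inc? v b

      -- The two edges of a pair, being disjoint, are going to share a colour; `as` and `bs` hold
      -- the edges left alone.
      record Pairing (ps : List (E × E)) (as bs : List E) : Set where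
        field
          left  : A ↭ map proj₁ ps ++ as
          right : B ↭ map proj₂ ps ++ bs
          apart : All (λ p → ¬ Share (proj₁ p) (proj₂ p)) ps
      open Pairing

      -- An upper bound for the number of colours on the edges at `x` or `y` once each pair shares
      -- one colour.
      size : List (E × E) → List E → List E → ℕ
      size ps as bs = (length ps + (length as + length bs)) + length M

      private
        length-left : ∀ {ps as bs} → Pairing ps as bs → length A ≡ length ps + length as
        length-left {ps} π = trans (↭-length (π .left)) (trans (length-++ (map proj₁ ps)) (cong (_+ _) (length-map proj₁ ps)))

        length-right : ∀ {ps as bs} → Pairing ps as bs → length B ≡ length ps + length bs
        length-right {ps} π = trans (↭-length (π .right)) (trans (length-++ (map proj₂ ps)) (cong (_+ _) (length-map proj₂ ps)))

        move : ∀ {X : List E} {a} ls {as as′} → X ↭ ls ++ as → as ↭ a ∷ as′ → X ↭ a ∷ ls ++ as′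
        move ls p q = ↭-trans p (↭-trans (Perm.++⁺ˡ ls q) (shift _ ls _))

        length-on : ∀ z {X ls as} → X ↭ ls ++ as → All (Inc z) as →
          length (filter (Inc? z) X) ≡ length (filter (Inc? z) ls) + length as
        length-on z {X} {ls} {as} p zas = begin
          length (filter (Inc? z) X)                                  ≡⟨ ↭-length (Perm.filter-↭ (Inc? z) p) ⟩
          length (filter (Inc? z) (ls ++ as))                         ≡⟨ cong length (filter-++ (Inc? z) ls as) ⟩
          length (filter (Inc? z) ls ++ filter (Inc? z) as)           ≡⟨ length-++ (filter (Inc? z) ls) ⟩
          length (filter (Inc? z) ls) + length (filter (Inc? z) as)   ≡⟨ cong (λ l → length (filter (Inc? z) ls) + length l) (filter-all (Inc? z) zas) ⟩
          length (filter (Inc? z) ls) + length as                     ∎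
          where open ≡-Reasoning

      -- If no disjoint pair is left, all unpaired edges end in a common z.  As the triangle xyz has
      -- at most k edges, some pair avoids z, and it can be exchanged for two pairs.
      pairing : ∀ fuel {ps as bs} → Pairing ps as bs → length as ≤ fuel →
        ∃ λ ps → ∃ λ as → ∃ λ bs → Pairing ps as bs × size ps as bs ≤ k
      pairing fuel {ps} {as} {bs} π as≤ with size ps as bs ≤? k
      ... | yes small = ps , as , bs , π , small
      -- With no unpaired edge on one side, `size` is the degree of `y`, or that of `x` in the next
      -- clause, and the star bound applies.
      pairing fuel {ps} {[]} {bs} π as≤ | no big =
        ⊥-elim (big (subst (λ l → l + length M ≤ k) (length-right π) B++M≤k))
      pairing fuel {ps} {as} {[]} π as≤ | no big =
        ⊥-elim (big (subst (λ l → l + length M ≤ k) (trans (length-left π) (cong (length ps +_) (sym (+-identityʳ _)))) A++M≤k))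
      pairing (suc fuel) {ps} {as@(a₀ ∷ as₀)} {bs@(b₀ ∷ bs₀)} π (s≤s as≤) | no big
        with Finₚ.any? (λ a → Finₚ.any? λ b → (a ∈? as) ×-dec (b ∈? bs) ×-dec ¬? (share? a b))
      ... | yes (a , b , a∈ , b∈ , ¬sh) with as′ , as↭ ← ∈⇒↭∷ a∈ with bs′ , bs↭ ← ∈⇒↭∷ b∈ =
        pairing fuel {(a , b) ∷ ps} {as′} {bs′}
          (record { left = move (map proj₁ ps) (π .left) as↭ ; right = move (map proj₂ ps) (π .right) bs↭ ; apart = ¬sh ∷ π .apart })
          (≤-trans (≤-reflexive (suc-injective (sym (↭-length as↭)))) as≤)
      ... | no none = exchange
        where
        ps-as-inc : All (λ e → Inc x e × ¬ Inc y e) (map proj₁ ps ++ as)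
        ps-as-inc = All-resp-↭ (π .left) A-inc
        ps-bs-inc : All (λ e → Inc y e × ¬ Inc x e) (map proj₂ ps ++ bs)
        ps-bs-inc = All-resp-↭ (π .right) B-inc
        as-inc : ∀ {a} → a ∈ as → Inc x a × ¬ Inc y a
        as-inc a∈ = All.lookup ps-as-inc (∈-++⁺ʳ (map proj₁ ps) a∈)
        bs-inc : ∀ {b} → b ∈ bs → Inc y b × ¬ Inc x b
        bs-inc b∈ = All.lookup ps-bs-inc (∈-++⁺ʳ (map proj₂ ps) b∈)
        shares : ∀ {a b} → a ∈ as → b ∈ bs → Share a b
        shares {a} {b} a∈ b∈ with share? a b
        ... | yes sh = sh
        ... | no ¬sh = ⊥-elim (none (a , b , a∈ , b∈ , ¬sh))
        -- Every unpaired edge of `B` meets `a₀`, but not in `x`, hence in its other end `z`; then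
        -- every unpaired edge of `A` meets `b₀` in `z` as well.
        z = proj₁ (other-end (proj₁ (as-inc (here refl))))
        xza₀ : Link x z a₀
        xza₀ = proj₂ (other-end (proj₁ (as-inc (here refl))))
        z-bs : ∀ {b} → b ∈ bs → Inc z b
        z-bs b∈ with v , va , vb ← shares (here refl) b∈ with link-ends xza₀ va
        ... | inj₁ refl = ⊥-elim (proj₂ (bs-inc b∈) vb)
        ... | inj₂ refl = vb
        yzb₀ : Link y z b₀
        yzb₀ = (λ y≡z → proj₂ (as-inc (here refl)) (subst (λ v → Inc v a₀) (sym y≡z) (proj₂ (proj₂ xza₀)))) ,
          proj₁ (bs-inc (here refl)) , z-bs (here refl)
        z-as : ∀ {a} → a ∈ as → Inc z a
        z-as a∈ with v , va , vb ← shares a∈ (here refl) with link-ends yzb₀ vb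
        ... | inj₁ refl = ⊥-elim (proj₂ (as-inc a∈) va)
        ... | inj₂ refl = va
        off? : ∀ (p : E × E) → Dec (¬ Inc z (proj₁ p) × ¬ Inc z (proj₂ p))
        off? (a , b) = ¬? (Inc? z a) ×-dec ¬? (Inc? z b)
        too-many : ¬ All (λ p → Inc z (proj₁ p) ⊎ Inc z (proj₂ p)) ps
        too-many on = big (begin
          (length ps + (length as + length bs)) + length M
            ≤⟨ +-monoˡ-≤ (length M) (+-monoˡ-≤ (length as + length bs) (length-pairs-≤ (Inc? z) on)) ⟩
          ((i + j) + (length as + length bs)) + length M
            ≡⟨ regroup i j (length as) (length bs) (length M) ⟩
          (i + length as) + ((j + length bs) + length M)
            ≡⟨ cong₂ (λ p q → p + (q + length M)) (length-on z (π .left) (All.tabulate z-as)) (length-on z (π .right) (All.tabulate z-bs)) ⟨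
          length (filter (Inc? z) A) + (length (filter (Inc? z) B) + length M)
            ≤⟨ triangle-count z ⟩
          k ∎)
          where
          open ≤-Reasoning
          i = length (filter (Inc? z) (map proj₁ ps))
          j = length (filter (Inc? z) (map proj₂ ps))
          regroup : ∀ i j a b c → ((i + j) + (a + b)) + c ≡ (i + a) + ((j + b) + c)
          regroup = solve-∀
        exchange : ∃ λ ps → ∃ λ as → ∃ λ bs → Pairing ps as bs × size ps as bs ≤ k
        exchange with Any.any? off? ps
        ... | no none′ = ⊥-elim (too-many (All.map on (Allₚ.¬Any⇒All¬ ps none′)))
          where
          on : ∀ {p} → ¬ (¬ Inc z (proj₁ p) × ¬ Inc z (proj₂ p)) → Inc z (proj₁ p) ⊎ Inc z (proj₂ p)
          on {a , b} ¬off with Inc? z a | Inc? z b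
          ... | yes p | _ = inj₁ p
          ... | no _ | yes q = inj₂ q
          ... | no p | no q = ⊥-elim (¬off (p , q))
        ... | yes some with (a , b) , ab∈ , ¬za , ¬zb ← find some with ps′ , ps↭ ← ∈⇒↭∷ ab∈
          with All-resp-↭ ps↭ (π .apart)
        -- The old pair avoids `z`, while `a₀` joins `x` to `z` and `b₀` joins `y` to `z`, so both
        -- crossed pairs are disjoint. The unpaired list loses `a₀`, which pays for the fuel.
        ...   | _ ∷ apart′ = pairing fuel {(a , b₀) ∷ (a₀ , b) ∷ ps′} {as₀} {bs₀}
                (record
                  { left = ↭-trans (move (map proj₁ ps) (π .left) ↭-refl)
                      (↭-trans (prep a₀ (Perm.++⁺ʳ as₀ (Perm.map⁺ proj₁ ps↭))) (swap a₀ a ↭-refl))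
                  ; right = ↭-trans (move (map proj₂ ps) (π .right) ↭-refl)
                      (prep b₀ (Perm.++⁺ʳ bs₀ (Perm.map⁺ proj₂ ps↭)))
                  ; apart = ¬sh-a ∷ ¬sh-b ∷ apart′ }) as≤
          where
          ¬sh-a : ¬ Share a b₀
          ¬sh-a (v , va , vb) with link-ends yzb₀ vb
          ... | inj₁ refl = proj₂ (All.lookup ps-as-inc (∈-++⁺ˡ (∈-map⁺ proj₁ ab∈))) va
          ... | inj₂ refl = ¬za va
          ¬sh-b : ¬ Share a₀ b
          ¬sh-b (v , va , vb) with link-ends xza₀ va
          ... | inj₁ refl = proj₂ (All.lookup ps-bs-inc (∈-++⁺ˡ (∈-map⁺ proj₂ ab∈))) vb
          ... | inj₂ refl = ¬zb vb

      -- `bs` holds edges, not colours, so that an edge given a fresh colour can simply be dropped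
      -- from it; `covers-++` reads off the remaining colours at the end.
      Covers : List ℕ → List E → List E → (E → ℕ) → Set
      Covers L bs R φ = ∀ {e} → e ∉ R → Inc x e ⊎ Inc y e → φ e ∈ L ⊎ e ∈ bs

      -- Each edge of `A` takes a fresh colour, which enters `L′`. The `B`-edge of a pair receives
      -- the same colour and gives up its own, so a pair contributes to `L′` only once.
      colour-pairs : ∀ ps as {bs C φ L} → Proper C (map proj₁ ps ++ (as ++ M)) φ →
        All (λ p → ¬ Share (proj₁ p) (proj₂ p)) ps → Covers L (map proj₂ ps ++ bs) (map proj₁ ps ++ (as ++ M)) φ →
        ∃ λ φ′ → ∃ λ L′ → Proper ((length ps + length as) + C) M φ′ × Covers L′ bs M φ′ ×
          length L′ ≡ (length ps + length as) + length L
      colour-pairs [] [] P [] cov = _ , _ , P , cov , refl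
      colour-pairs [] (a ∷ as) {bs} {C} {φ} {L} P [] cov
        with colour-pairs [] as {L = C ∷ L} (insert-fresh P) [] cov₁
        where
        cov₁ : Covers (C ∷ L) bs (as ++ M) (φ [ a ≔ C ])
        cov₁ {e} e∉ i with e Fin.≟ a
        ... | yes _ = inj₁ (here refl)
        ... | no e≢a with cov (∉-∷ e≢a e∉) i
        ...   | inj₁ p = inj₁ (there p)
        ...   | inj₂ p = inj₂ p
      ... | φ′ , L′ , P′ , cov′ , eq =
        φ′ , L′ , weaken (≤-reflexive (+-suc _ C)) id P′ , cov′ , trans eq (+-suc _ _)
      colour-pairs ((a , b) ∷ ps) as {bs} {C} {φ} {L} P (¬sh ∷ apart) cov
        with colour-pairs ps as {L = C ∷ L} (insert-fresh-pair P (λ va vb → ¬sh (_ , va , vb))) apart cov₁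
        where
        cov₁ : Covers (C ∷ L) (map proj₂ ps ++ bs) (map proj₁ ps ++ (as ++ M)) ((φ [ b ≔ C ]) [ a ≔ C ])
        cov₁ {e} e∉ i with e Fin.≟ a
        ... | yes _ = inj₁ (here refl)
        ... | no e≢a with e Fin.≟ b
        ...   | yes _ = inj₁ (here refl)
        ...   | no e≢b with cov (∉-∷ e≢a e∉) i
        ...     | inj₁ p = inj₁ (there p)
        ...     | inj₂ (here p) = ⊥-elim (e≢b p)
        ...     | inj₂ (there p) = inj₂ p
      ... | φ′ , L′ , P′ , cov′ , eq =
        φ′ , L′ , weaken (≤-reflexive (+-suc _ C)) id P′ , cov′ , trans eq (+-suc _ _)

      -- An edge joining `x` and `y` meets only edges at `x` or `y`, and the colours of these are
      -- all in `L`. As `length L + length N` stays at most `k`, some colour below `k` is always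
      -- left.
      ¬-fill : ∀ N {L φ} → All (λ e → Inc x e × Inc y e) N → Proper k N φ → Covers L [] N φ → length L + length N ≤ k → ⊥
      ¬-fill [] _ P cov small = ¬colourable _ P
      ¬-fill (e ∷ N) {L} {φ} ((xe , ye) ∷ iN) P cov small
        with c , c<k , c∉ ← ∃-missing k L (≤-trans (≤-trans (s≤s (m≤m+n _ (length N))) (≤-reflexive (sym (+-suc _ _)))) small) =
        ¬-fill N {c ∷ L} iN (insert P c<k free) cov₁ (≤-trans (≤-reflexive (sym (+-suc _ _))) small)
        where
        free : ∀ {v} → Inc v e → Misses (e ∷ N) φ v c
        free ve f∉ vf eq with cov f∉ at
          where
          at = [ (λ { refl → inj₁ vf }) , (λ { refl → inj₂ vf }) ]′ (link-ends (x≢y , xe , ye) ve)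
        ... | inj₁ p = c∉ (subst (_∈ L) eq p)
        cov₁ : Covers (c ∷ L) [] N (φ [ e ≔ c ])
        cov₁ {f} f∉ i with f Fin.≟ e
        ... | yes _ = inj₁ (here refl)
        ... | no f≢e with cov (∉-∷ f≢e f∉) i
        ...   | inj₁ p = inj₁ (there p)

      private
        star⊆ : ∀ {ps as bs} → Pairing ps as bs → star x ⊆ map proj₁ ps ++ (as ++ M)
        star⊆ {ps} {as} π {e} e∈ with Inc? y e
        ... | yes ye = ∈-++⁺ʳ (map proj₁ ps) (∈-++⁺ʳ as (∈-filter⁺ (Inc? y) e∈ ye))
        ... | no ¬ye = [ ∈-++⁺ˡ , (λ p → ∈-++⁺ʳ (map proj₁ ps) (∈-++⁺ˡ p)) ]′
                         (∈-++⁻ (map proj₁ ps) (∈-resp-↭ (π .left) (∈-filter⁺ (¬? ∘ Inc? y) e∈ ¬ye)))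

        covers-B : ∀ {ps as bs φ} → Pairing ps as bs → Covers [] (map proj₂ ps ++ bs) (map proj₁ ps ++ (as ++ M)) φ
        covers-B π {e} e∉ i with Inc? x e
        ... | yes xe = ⊥-elim (e∉ (star⊆ π (∈-star xe)))
        ... | no ¬xe = inj₂ (∈-resp-↭ (π .right) (∈-filter⁺ (¬? ∘ Inc? x) (∈-star ([ (λ p → ⊥-elim (¬xe p)) , id ]′ i)) ¬xe))

        covers-++ : ∀ {φ L bs} → Covers L bs M φ → Covers (L ++ map φ bs) [] M φ
        covers-++ {φ} {L} cov e∉ i with cov e∉ i
        ... | inj₁ p = inj₁ (∈-++⁺ˡ p)
        ... | inj₂ p = inj₁ (∈-++⁺ʳ L (∈-map⁺ φ p))

      -- The fresh colours number `length A`, so at most `k` colours are in use before `M` is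
      -- treated. The bound on `size` then lets `¬-fill` colour all of `M`.
      heavy-pair : ∀ {C φ} → Proper C (star x) φ → length A + C ≤ k → ⊥
      heavy-pair {C} {φ} P AC≤k
        with ps , as , bs , π , small ← pairing (length A) {[]} {A} {B} (record { left = ↭-refl ; right = ↭-refl ; apart = [] }) ≤-refl
        with φ′ , L , P′ , cov , eq ← colour-pairs ps as {bs} {C} {φ} {[]} (weaken ≤-refl (star⊆ π) P) (π .apart) (covers-B {ps} {as} {bs} {φ} π) =
        ¬-fill M {L ++ map φ′ bs} M-inc
          (weaken (subst (λ l → l + C ≤ k) (length-left π) AC≤k) id P′) (covers-++ {φ′} {L} {bs} cov)
          (subst (_≤ k) (sym (cong (_+ length M) (begin
            length (L ++ map φ′ bs)                          ≡⟨ length-++ L ⟩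
            length L + length (map φ′ bs)                    ≡⟨ cong₂ _+_ (trans eq (+-identityʳ _)) (length-map φ′ bs) ⟩
            (length ps + length as) + length bs              ≡⟨ +-assoc (length ps) _ _ ⟩
            length ps + (length as + length bs)              ∎))) small)
        where open ≡-Reasoning

-- As much as possible is taken from `a`, namely the smaller of `a` and `s ∸ r`, and the rest from
-- `b`.
choose-sizes : ∀ {r s a b} → r + r ≤ s → s ≤ a + b → r ≤ a → r ≤ b →
  ∃₂ λ i j → i + j ≡ s × r ≤ i × i ≤ a × r ≤ j × j ≤ b
choose-sizes {r} {s} {a} {b} 2r≤s s≤a+b r≤a r≤b with a ≤? s ∸ r
... | yes a≤s∸r = a , s ∸ a , m+[n∸m]≡n (≤-trans a≤s∸r (m∸n≤m s r)) , r≤a , ≤-refl ,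
        m+n≤o⇒m≤o∸n r (subst (_≤ s) (+-comm a r) (m≤o∸n⇒m+n≤o a (≤-trans (m≤m+n r r) 2r≤s) a≤s∸r)) ,
        m≤n+o⇒m∸n≤o s a s≤a+b
... | no a≰s∸r = s ∸ r , r , m∸n+n≡m (≤-trans (m≤m+n r r) 2r≤s) , m+n≤o⇒m≤o∸n r 2r≤s ,
        <⇒≤ (≰⇒> a≰s∸r) , ≤-refl , r≤b

length-take-≤ : {A : Set} {i : ℕ} (xs : List A) → i ≤ length xs → length (take i xs) ≡ i
length-take-≤ {i = i} xs i≤ = trans (length-take i xs) (m≤n⇒m⊓n≡m i≤)

-- Cliques and colourings of the line graph.

module LineGraphClique (G : Multigraph) where

  open EdgeColouring G
  open DecMembership (Fin._≟_ {m G}) using (_∈?_)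

  star-clique : ∀ {x Q} → Unique Q → All (Inc x) Q → IsClique (LineGraph G) Q
  star-clique Q! xQ = Q! , λ e f e∈ f∈ e≢f → e≢f , _ , All.lookup xQ e∈ , All.lookup xQ f∈

  triangle-clique : ∀ {x y z Q} → Unique Q → All (InTriangle x y z) Q → IsClique (LineGraph G) Q
  triangle-clique {x} {y} {z} Q! tQ = Q! , λ e f e∈ f∈ e≢f → e≢f , meet (All.lookup tQ e∈) (All.lookup tQ f∈)
    where
    meet : ∀ {e f} → InTriangle x y z e → InTriangle x y z f → ∃ λ v → Inc v e × Inc v f
    meet (inj₁ (a , b)) (inj₁ (c , d)) = _ , a , c
    meet (inj₁ (a , b)) (inj₂ (inj₁ (c , d))) = _ , a , c
    meet (inj₁ (a , b)) (inj₂ (inj₂ (c , d))) = _ , b , c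
    meet (inj₂ (inj₁ (a , b))) (inj₁ (c , d)) = _ , a , c
    meet (inj₂ (inj₁ (a , b))) (inj₂ (inj₁ (c , d))) = _ , a , c
    meet (inj₂ (inj₁ (a , b))) (inj₂ (inj₂ (c , d))) = _ , b , d
    meet (inj₂ (inj₂ (a , b))) (inj₁ (c , d)) = _ , a , d
    meet (inj₂ (inj₂ (a , b))) (inj₂ (inj₁ (c , d))) = _ , b , d
    meet (inj₂ (inj₂ (a , b))) (inj₂ (inj₂ (c , d))) = _ , a , c

  Proper⇒Colorable : ∀ {k φ} → Proper k [] φ → Colorable (LineGraph G) k
  Proper⇒Colorable {k} {φ} P = (λ e → fromℕ< (P .bound {e} λ ())) ,
    λ { e f (e≢f , v , ve , vf) eq → e≢f (P .inj (λ ()) (λ ()) ve vf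
      (trans (sym (toℕ-fromℕ< _)) (trans (cong toℕ eq) (toℕ-fromℕ< _)))) }
    where open Proper

  Colorable⇒Proper : ∀ {j} Q → Colorable (deleteVertices (LineGraph G) Q) j → ∃ λ φ → Proper j Q φ
  Colorable⇒Proper {j} Q (c , ok) = φ , record { bound = bound′ ; inj = inj′ }
    where
    φ : E → ℕ
    φ e with e ∈? Q
    -- A default value: `Proper` constrains only the edges outside `Q`.
    ... | yes _ = 0
    ... | no e∉ = toℕ (c (e , e∉))
    bound′ : ∀ {e} → e ∉ Q → φ e < j
    bound′ {e} e∉ with e ∈? Q
    ... | yes e∈ = ⊥-elim (e∉ e∈)
    ... | no _ = toℕ<n _
    inj′ : ∀ {v e f} → e ∉ Q → f ∉ Q → Inc v e → Inc v f → φ e ≡ φ f → e ≡ f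
    inj′ {v} {e} {f} e∉ f∉ ve vf eq with e ∈? Q | f ∈? Q
    ... | yes e∈ | _ = ⊥-elim (e∉ e∈)
    ... | no _ | yes f∈ = ⊥-elim (f∉ f∈)
    ... | no _ | no _ with e Fin.≟ f
    ...   | yes e≡f = e≡f
    ...   | no e≢f = ⊥-elim (ok _ _ (e≢f , v , ve , vf) (toℕ-injective eq))

-- Here s and t are the s − 2 and t − 1 of the theorem.
module Main (s t ℓ : ℕ) (3ℓ+2≤s+3 : ℓ + (suc ℓ + suc ℓ) ≤ 3 + s) (2ℓ≤s : ℓ + ℓ ≤ s) (s<t : suc s ≤ t)
  (G : Multigraph) (ω : ℕ) (min : ChromaticAtLeast (LineGraph G) (suc (s + suc t)))
  (max : ∀ Q → IsClique (LineGraph G) Q → length Q ≤ ω) (ω≤k : ω ≤ s + suc t) where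

  open EdgeColouring G
  open LineGraphClique G

  k C : ℕ
  k = s + suc t
  C = t + ℓ

  open Bounded k
    (λ x L L! xL → ≤-trans (max L (star-clique L! xL)) ω≤k)
    (λ x y z L L! tL → ≤-trans (max L (triangle-clique L! tL)) ω≤k)
    (λ φ P → 1+n≰n (min k (Proper⇒Colorable P)))

  Goal : Set
  Goal = ∃ λ Q → IsClique (LineGraph G) Q × length Q ≡ 2 + s ×
    ChromaticAtLeast (deleteVertices (LineGraph G) Q) (suc t + ℓ)

  star-witness : ∀ {x} Q → Unique Q → All (Inc x) Q → length Q ≡ 2 + s → (∀ {φ} → ¬ Proper C Q φ) → Goal
  star-witness Q Q! xQ |Q| ¬P = Q , star-clique Q! xQ , |Q| , at-least
    where
    at-least : ChromaticAtLeast (deleteVertices (LineGraph G) Q) (suc t + ℓ)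
    at-least j c with suc t + ℓ ≤? j
    ... | yes p = p
    ... | no p = ⊥-elim (¬P (weaken (≤-pred (≰⇒> p)) id (proj₂ (Colorable⇒Proper Q c))))

  -- The surplus over `k` is the number of rounds asked of `spread-star` and `split-star`.
  budget : ∀ (Q : List E) → length Q ≡ 2 + s → C + length Q ≡ k + suc ℓ
  budget Q |Q| = trans (cong (C +_) |Q|) (arith t ℓ s)
    where
    arith : ∀ t ℓ s → (t + ℓ) + (2 + s) ≡ (s + suc t) + suc ℓ
    arith = solve-∀

  -- The three cases for a vertex of large degree.

  module _ {x : W} (s≤d : 2 + s ≤ length (star x)) where

    Q = take (2 + s) (star x)

    |Q| : length Q ≡ 2 + s
    |Q| = length-take-≤ (star x) s≤d

    Q! : Unique Q
    Q! = Uniqueₚ.take⁺ (2 + s) (star-unique x)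

    xQ : All (Inc x) Q
    xQ = Allₚ.take⁺ (2 + s) (star-incident x)

    spread-case : (∀ {y} → x ≢ y → length (common-edges x y) ≤ ℓ) → Goal
    spread-case thin = star-witness Q Q! xQ |Q| λ P →
      spread-star thin′ P Q! xQ (subst (λ l → ℓ + (suc ℓ + suc ℓ) ≤ suc l) (sym |Q|) 3ℓ+2≤s+3) (budget Q |Q|)
      where
      thin′ : ∀ {y} L → x ≢ y → Unique L → All (Inc x) L → All (Inc y) L → length L ≤ ℓ
      thin′ {y} L x≢y L! xL yL = ≤-trans (unique-⊆⇒length≤ L!
        (λ e∈ → ∈-filter⁺ (Inc? y) (∈-star (All.lookup xL e∈)) (All.lookup yL e∈))) (thin x≢y)

    -- All edges at `x` are uncoloured, not only those of `Q`; `2ℓ≤s` leaves room below `k` for one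
    -- new colour per private edge.
    heavy-case : ∀ {y} → x ≢ y → length (private-edges x y) ≤ ℓ → Goal
    heavy-case {y} x≢y A≤ℓ = star-witness Q Q! xQ |Q| λ P →
      HeavyPair.heavy-pair x≢y (weaken ≤-refl (λ p → ∈-star (All.lookup xQ p)) P) (begin
        length (private-edges x y) + C  ≤⟨ +-monoˡ-≤ C A≤ℓ ⟩
        ℓ + (t + ℓ)                     ≡⟨ arith ℓ t ⟩
        (ℓ + ℓ) + t                     ≤⟨ +-mono-≤ 2ℓ≤s (n≤1+n t) ⟩
        s + suc t                       ∎)
      where
      open ≤-Reasoning
      arith : ∀ ℓ t → ℓ + (t + ℓ) ≡ (ℓ + ℓ) + t
      arith = solve-∀

    -- Here `Q` is composed anew, with at least `ℓ + 1` edges to `y` and at least `ℓ + 1` others, so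
    -- that each of the `ℓ + 1` rounds finds one of each.
    split-case : ∀ {y} → x ≢ y → ℓ < length (common-edges x y) → ℓ < length (private-edges x y) → Goal
    split-case {y} x≢y ℓ<M ℓ<N
      with i , j , i+j≡ , r≤i , i≤ , r≤j , j≤ ← choose-sizes {suc ℓ} {2 + s} {length (common-edges x y)} {length (private-edges x y)}
             (s≤s (subst (_≤ suc s) (sym (+-suc ℓ ℓ)) (s≤s 2ℓ≤s)))
             (≤-trans s≤d (≤-reflexive (length-filter-split (Inc? y) (star x)))) ℓ<M ℓ<N =
      star-witness (M ++ N) M++N! xMN |MN| λ P →
        split-star x≢y P M++N! xMN yM ¬yN (subst (suc ℓ ≤_) (sym |M|) r≤i) (subst (suc ℓ ≤_) (sym |N|) r≤j) (budget (M ++ N) |MN|)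
      where
      M = take i (common-edges x y)
      N = take j (private-edges x y)
      |M| : length M ≡ i
      |M| = length-take-≤ (common-edges x y) i≤
      |N| : length N ≡ j
      |N| = length-take-≤ (private-edges x y) j≤
      |MN| : length (M ++ N) ≡ 2 + s
      |MN| = trans (length-++ M) (trans (cong₂ _+_ |M| |N|) i+j≡)
      yM : All (Inc y) M
      yM = Allₚ.take⁺ i (all-filter (Inc? y) (star x))
      ¬yN : All (λ e → ¬ Inc y e) N
      ¬yN = Allₚ.take⁺ j (all-filter (¬? ∘ Inc? y) (star x))
      M++N! : Unique (M ++ N)
      M++N! = Uniqueₚ.++⁺ (Uniqueₚ.take⁺ i (Uniqueₚ.filter⁺ (Inc? y) (star-unique x)))
        (Uniqueₚ.take⁺ j (Uniqueₚ.filter⁺ (¬? ∘ Inc? y) (star-unique x)))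
        λ { (p , q) → All.lookup ¬yN q (All.lookup yM p) }
      xMN : All (Inc x) (M ++ N)
      xMN = Allₚ.++⁺ (Allₚ.take⁺ i (Allₚ.filter⁺ (Inc? y) (star-incident x)))
        (Allₚ.take⁺ j (Allₚ.filter⁺ (¬? ∘ Inc? y) (star-incident x)))

    big-star : Goal
    big-star with Finₚ.any? (λ y → ¬? (x Fin.≟ y) ×-dec (suc ℓ ≤? length (common-edges x y)))
    ... | no none = spread-case λ x≢y → ≮⇒≥ λ p → none (_ , x≢y , p)
    ... | yes (y , x≢y , ℓ<M) with length (private-edges x y) ≤? ℓ
    ...   | yes A≤ℓ = heavy-case x≢y A≤ℓ
    ...   | no A≰ℓ = split-case x≢y ℓ<M (≰⇒> A≰ℓ)

  goal : Goal
  goal with Finₚ.any? (λ x → 2 + s ≤? length (star x))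
  ... | yes (x , s≤d) = big-star s≤d
  -- Without a vertex of degree `2 + s`, greedy colouring starts from `blank`, where every edge is
  -- uncoloured and 0 is a placeholder; its outcome contradicts `min`.
  ... | no none = ⊥-elim (1+n≰n (min k (Proper⇒Colorable (proj₂ (greedy 2d≤k small (allFin (m G)) {λ _ → 0} blank)))))
    where
    small : ∀ x L → Unique L → All (Inc x) L → length L ≤ suc s
    small x L L! xL = ≤-trans (unique-⊆⇒length≤ L! (λ e∈ → ∈-star (All.lookup xL e∈)))
      (≤-pred (≰⇒> λ p → none (x , p)))
    2d≤k : suc s + suc s ≤ k
    2d≤k = subst (_≤ k) (+-suc s (suc s)) (+-monoʳ-≤ s (s≤s s<t))
    blank : Proper k (allFin (m G)) (λ _ → 0)
    blank = record { bound = λ e∉ → ⊥-elim (e∉ (∈-allFin _)) ; inj = λ e∉ → ⊥-elim (e∉ (∈-allFin _)) }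

theorem1 : (s t ℓ : ℕ) → 7 * ℓ + 4 ≤ 2 * s → s ≤ t →
    (G : Multigraph) → (χ ω : ℕ) →
    IsChromaticNumber (LineGraph G) χ → IsCliqueNumber (LineGraph G) ω →
    χ ≡ s + t ∸ 1 → ω < χ →
    ∃ λ (Q : List (V (LineGraph G))) → IsClique (LineGraph G) Q × length Q ≡ s ×
    ChromaticAtLeast (deleteVertices (LineGraph G) Q) (t + ℓ)
theorem1 s t ℓ 7ℓ+4≤2s s≤t G χ ω (_ , min) (_ , max) χ≡ ω<χ = bounds s t s≤t χ≡ large larger
  where
  open ≤-Reasoning
  -- In the heavy case this keeps the colours within `k`; in the split case it lets `Q` hold `ℓ + 1`
  -- edges of both kinds. Both sides are doubled to match the integral form of the hypothesis.
  large : 2 + (ℓ + ℓ) ≤ s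
  large = *-cancelˡ-≤ 2 (begin
    2 * (2 + (ℓ + ℓ))   ≡⟨ lhs ℓ ⟩
    4 * ℓ + 4           ≤⟨ +-monoˡ-≤ 4 (*-monoˡ-≤ ℓ (m≤m+n 4 3)) ⟩
    7 * ℓ + 4           ≤⟨ 7ℓ+4≤2s ⟩
    2 * s               ∎)
    where
    lhs : ∀ ℓ → 2 * (2 + (ℓ + ℓ)) ≡ 4 * ℓ + 4
    lhs = solve-∀
  -- The size that `spread-star` asks of `Q` for `ℓ + 1` rounds.
  larger : ℓ + (suc ℓ + suc ℓ) ≤ suc s
  larger = *-cancelˡ-≤ 2 (begin
    2 * (ℓ + (suc ℓ + suc ℓ))   ≡⟨ lhs ℓ ⟩
    6 * ℓ + 4                   ≤⟨ +-monoˡ-≤ 4 (*-monoˡ-≤ ℓ (m≤m+n 6 1)) ⟩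
    7 * ℓ + 4                   ≤⟨ 7ℓ+4≤2s ⟩
    2 * s                       ≤⟨ *-monoʳ-≤ 2 (n≤1+n s) ⟩
    2 * suc s                   ∎)
    where
    lhs : ∀ ℓ → 2 * (ℓ + (suc ℓ + suc ℓ)) ≡ 6 * ℓ + 4
    lhs = solve-∀
  bounds : ∀ s t → s ≤ t → χ ≡ s + t ∸ 1 → 2 + (ℓ + ℓ) ≤ s → ℓ + (suc ℓ + suc ℓ) ≤ suc s →
    ∃ λ (Q : List (V (LineGraph G))) → IsClique (LineGraph G) Q × length Q ≡ s ×
    ChromaticAtLeast (deleteVertices (LineGraph G) Q) (t + ℓ)
  -- `large` makes `s` at least 2, and `t` is at least `s`, so the shifts by 2 and by 1 are
  -- possible; in the shifted variables `χ` is `suc (s + suc t)`.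
  bounds (suc (suc s)) (suc t) (s≤s s<t) refl (s≤s (s≤s 2ℓ≤s)) larger =
    Main.goal s t ℓ larger 2ℓ≤s s<t G ω min max (≤-pred ω<χ)
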